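{- Suppose that there exists an approximation algorithm for $\textsc{Min-Max}~\mathcal{P}$ with a worst case ratio of $\gamma>1$. Let $\hat X\in\Phi$ be a solution constructed by this algorithm. Then for any $\alpha\in(0,1]$ and any $X\in\Phi$ it holds $$\mathrm{OWA}(\hat X)\le\begin{cases}\gamma\cdot\mathrm{OWA}(X)&\text{if }\alpha=1\text{ or }\min_{1\le j\le K}F(\hat X,\pmb{c}_j)=0,\\[2pt]\dfrac{\gamma}{\alpha}\cdot\mathrm{OWA}(X)&\text{if }\alpha\in(0,1),\end{cases}$$ where $\mathrm{OWA}(X)=\alpha\max_{1\le j\le K}F(X,\pmb{c}_j)+(1-\alpha)\min_{1\le j\le K}F(X,\pmb{c}_j)$ is the Hurwicz criterion.
   Context: An instance of $\textsc{Min-Max}~\mathcal{P}$ consists of a finite set of elements $E=\{e_1,\dots,e_n\}$, a (nonempty) set of feasible solutions $\Phi\subseteq2^E$ of the combinatorial optimization problem $\mathcal{P}$, and a scenario set $\Gamma=\{\pmb{c}_1,\dots,\pmb{c}_K\}$ of $K$ distinct cost scenarios $\pmb{c}_j=(c_{1j},\dots,c_{nj})$ with nonnegative entries. With $F(X,\pmb{c}_j)=\sum_{e_i\in X}c_{ij}$, $\textsc{Min-Max}~\mathcal{P}$ is the problem $\min_{X\in\Phi}\max_{1\le j\le K}F(X,\pmb{c}_j)$. An approximation algorithm with worst case ratio $\gamma$ returns, for every instance, some $\hat X\in\Phi$ with $\max_jF(\hat X,\pmb{c}_j)\le\gamma\min_{X\in\Phi}\max_jF(X,\pmb{c}_j)$.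 In the statement, $\hat X$ is the algorithm's output on the same $E,\Phi,\Gamma$ for which the Hurwicz criterion is evaluated. -}

module Defs where

open import Algebra.Bundles using (CommutativeRing)
open import Data.Bool.Base using (if_then_else_)
open import Data.Fin.Base using (Fin)
open import Data.Fin.Subset using (Subset; inside; outside)
open import Data.Fin.Subset.Properties using (_∈?_)
open import Data.List.Base using (List; []; _∷_; _++_; map; filter)
import Data.List.Extrema as Extrema
open import Data.Nat.Base using (ℕ; zero; suc)
open import Data.Product.Base using (Σ-syntax; proj₁; proj₂)
open import Data.Vec.Base using ([]; _∷_)
open import Data.Vec.Functional using (Vector; head; tail; toList)
import Data.Vec.Functional.Relation.Binary.Equality.Setoid as VecEq
open import Function.Definitions using (Injective)
open import Level using (Level; _⊔_) renaming (suc to lsuc)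
open import Relation.Binary.Bundles using (TotalOrder)
open import Relation.Binary.Core using (Rel)
import Relation.Binary.Construct.NonStrictToStrict as NonStrictToStrict
open import Relation.Binary.PropositionalEquality.Core using (_≡_)
open import Relation.Binary.Structures using (IsTotalOrder)
open import Relation.Nullary.Decidable.Core using (does)
open import Relation.Unary using (Pred; Decidable; Satisfiable)
import Algebra.Definitions.RawMonoid as RawMonoidOps

-- The library has no real numbers; costs, α and γ range over an arbitrary
-- totally ordered field, of which ℝ (classically) and ℚ are instances.
record OrderedField (c ℓ₁ ℓ₂ : Level) : Set (lsuc (c ⊔ ℓ₁ ⊔ ℓ₂)) where
  field
    commutativeRing : CommutativeRing c ℓ₁

  open CommutativeRing commutativeRing public

  infix 4 _≤_
  field
    _≤_          : Rel Carrier ℓ₂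
    isTotalOrder : IsTotalOrder _≈_ _≤_
    +-monoˡ-≤    : ∀ {x y} z → x ≤ y → x + z ≤ y + z
    *-nonNeg     : ∀ {x y} → 0# ≤ x → 0# ≤ y → 0# ≤ x * y
    0≉1          : 0# ≉ 1#
    inverse      : ∀ x → 0# ≉ x → Σ[ y ∈ Carrier ] x * y ≈ 1#

  totalOrder : TotalOrder c ℓ₁ ℓ₂
  totalOrder = record { isTotalOrder = isTotalOrder }

  open NonStrictToStrict _≈_ _≤_ public using (_<_)

  infixl 7 _/_⟨_⟩
  _/_⟨_⟩ : (x y : Carrier) → 0# < y → Carrier
  x / y ⟨ 0<y ⟩ = x * proj₁ (inverse y (proj₂ 0<y))

-- A combinatorial optimization problem 𝒫: a class of pairs (E , Φ), where
-- E = Fin (size i) and Φ is a nonempty set of subsets of E.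
record Problem (p q : Level) : Set (lsuc (p ⊔ q)) where
  field
    Index     : Set p
    size      : Index → ℕ
    Feasible  : ∀ i → Pred (Subset (size i)) q
    feasible? : ∀ i → Decidable (Feasible i)
    nonempty  : ∀ i → Satisfiable (Feasible i)

allSubsets : ∀ n → List (Subset n)
allSubsets zero    = [] ∷ []
allSubsets (suc n) =
  map (inside ∷_) (allSubsets n) ++ map (outside ∷_) (allSubsets n)

module MinMax {c ℓ₁ ℓ₂} (𝔽 : OrderedField c ℓ₁ ℓ₂) where

  open OrderedField 𝔽
  open Extrema totalOrder using (max; min)
  open RawMonoidOps +-rawMonoid using (sum)
  open VecEq setoid using (_≋_)

  F : ∀ {n} → Subset n → Vector Carrier n → Carrier
  F X cost = sum (λ e → if does (e ∈? X) then cost e else 0#)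

  maximum minimum : ∀ {k} → Vector Carrier (suc k) → Carrier
  maximum v = max (head v) (toList (tail v))
  minimum v = min (head v) (toList (tail v))

  -- The number of scenarios is K = suc k, so that Γ is nonempty;
  -- scenario j e is the cost of the element e under the j-th scenario.
  record Instance {p q} (P : Problem p q) : Set (p ⊔ q ⊔ c ⊔ ℓ₁ ⊔ ℓ₂) where
    open Problem P
    field
      index    : Index
      k        : ℕ
      scenario : Fin (suc k) → Vector Carrier (size index)
      nonNeg   : ∀ j e → 0# ≤ scenario j e
      distinct : Injective _≡_ _≋_ scenario

    Solution : Set
    Solution = Subset (size index)

    Φ : Pred Solution q
    Φ = Feasible index

    maxCost minCost : Solution → Carrier
    maxCost X = maximum (λ j → F X (scenario j))
    minCost X = minimum (λ j → F X (scenario j))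

    -- min_{X ∈ Φ} maxCost X. The first argument of min is the value of some
    -- member of Φ, hence it does not affect the result.
    optimum : Carrier
    optimum = min (maxCost (proj₁ (nonempty index)))
                  (map maxCost (filter (feasible? index) (allSubsets _)))

    -- The Hurwicz criterion.
    OWA : Carrier → Solution → Carrier
    OWA α X = α * maxCost X + (1# - α) * minCost X

  record ApproximationAlgorithm {p q} (P : Problem p q) (γ : Carrier)
         : Set (p ⊔ q ⊔ c ⊔ ℓ₁ ⊔ ℓ₂) where
    open Instance
    field
      output   : (I : Instance P) → Solution I
      feasible : ∀ I → Φ I (output I)
      ratio    : ∀ I → maxCost I (output I) ≤ γ * optimum I

{-# OPTIONS --safe #-}
-- Since X̂ is γ-approximate, maxCost X̂ ≤ γ · maxCost X for every feasible X.
-- The Hurwicz value is a convex combination of maxCost and minCost, so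
-- OWA X̂ ≤ maxCost X̂; costs being nonnegative, α · maxCost X ≤ OWA X. The
-- factor α lost in the second bound is not lost if α = 1 or minCost X̂ = 0,
-- because then OWA X̂ = α · maxCost X̂.
module Submission where

open import Defs
open import Data.Bool.Base using (Bool; true; false; if_then_else_)
open import Data.Fin.Base using (zero; suc)
open import Data.Fin.Subset using (Subset; inside; outside)
open import Data.Fin.Subset.Properties using (_∈?_)
import Data.List.Extrema as Extrema
open import Data.List.Membership.Propositional using (_∈_; lose)
open import Data.List.Membership.Propositional.Properties
  using (∈-map⁺; ∈-++⁺ˡ; ∈-++⁺ʳ; ∈-filter⁺)
open import Data.List.Relation.Unary.All.Properties using (tabulate⁺)
open import Data.List.Relation.Unary.Any using (here)
open import Data.Nat.Base using (zero; suc)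
open import Data.Product.Base using (_×_; _,_; proj₁; proj₂)
open import Data.Sum.Base using (_⊎_; inj₁; inj₂)
open import Data.Vec.Base using ([]; _∷_)
open import Data.Vec.Functional using (Vector; tail; toList)
open import Relation.Binary.Bundles using (TotalOrder)
import Relation.Binary.Reasoning.PartialOrder as ≤-Reasoning
open import Relation.Binary.PropositionalEquality.Core using (refl)
open import Relation.Nullary.Decidable.Core using (does)
import Algebra.Properties.Ring as RingProperties
import Algebra.Definitions.RawMonoid as RawMonoidOps

-- Needed because `optimum` is a minimum over a filtered enumeration: it bounds the cost of each
-- feasible `X` only if the enumeration misses none.
∈-allSubsets : ∀ {n} (X : Subset n) → X ∈ allSubsets n
∈-allSubsets []            = here refl
∈-allSubsets (inside  ∷ X) = ∈-++⁺ˡ (∈-map⁺ (inside ∷_) (∈-allSubsets X))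
∈-allSubsets (outside ∷ X) =
  ∈-++⁺ʳ _ (∈-map⁺ (outside ∷_) (∈-allSubsets X))

module OrderedFieldProperties {c ℓ₁ ℓ₂} (𝔽 : OrderedField c ℓ₁ ℓ₂) where

  open OrderedField 𝔽 hiding (zero)
  open RingProperties ring
  open RawMonoidOps +-rawMonoid using (sum)
  open TotalOrder totalOrder public
    using (poset; total)
    renaming (refl to ≤-refl; trans to ≤-trans)
  open ≤-Reasoning poset

  +-monoʳ-≤ : ∀ {x y} z → x ≤ y → z + x ≤ z + y
  +-monoʳ-≤ {x} {y} z x≤y = begin
    z + x  ≈⟨ +-comm z x ⟩
    x + z  ≤⟨ +-monoˡ-≤ z x≤y ⟩
    y + z  ≈⟨ +-comm y z ⟩
    z + y  ∎

  x≤x+y : ∀ {x y} → 0# ≤ y → x ≤ x + y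
  x≤x+y {x} {y} 0≤y = begin
    x       ≈⟨ +-identityʳ x ⟨
    x + 0#  ≤⟨ +-monoʳ-≤ x 0≤y ⟩
    x + y   ∎

  x≤y⇒0≤y-x : ∀ {x y} → x ≤ y → 0# ≤ y - x
  x≤y⇒0≤y-x {x} {y} x≤y = begin
    0#     ≈⟨ -‿inverseʳ x ⟨
    x - x  ≤⟨ +-monoˡ-≤ (- x) x≤y ⟩
    y - x  ∎

  x+[y-x]≈y : ∀ x y → x + (y - x) ≈ y
  x+[y-x]≈y x y = trans (+-comm x (y - x)) (//-rightDividesˡ x y)

  -- The ordered field axioms speak only of products of nonnegative elements, so `y` is split as
  -- `x + (y - x)` with a nonnegative second summand.
  *-monoʳ-≤-nonNeg : ∀ {x y} z → 0# ≤ z → x ≤ y → z * x ≤ z * y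
  *-monoʳ-≤-nonNeg {x} {y} z 0≤z x≤y = begin
    z * x                ≤⟨ x≤x+y (*-nonNeg 0≤z (x≤y⇒0≤y-x x≤y)) ⟩
    z * x + z * (y - x)  ≈⟨ distribˡ z x (y - x) ⟨
    z * (x + (y - x))    ≈⟨ *-congˡ (x+[y-x]≈y x y) ⟩
    z * y                ∎

  -- By totality, `x` or `- x` is nonnegative, and both have the same square.
  0≤x*x : ∀ x → 0# ≤ x * x
  0≤x*x x with total 0# x
  ... | inj₁ 0≤x = *-nonNeg 0≤x 0≤x
  ... | inj₂ x≤0 = begin
    0#           ≤⟨ *-nonNeg 0≤-x 0≤-x ⟩
    - x * - x    ≈⟨ -‿distribˡ-* x (- x) ⟨
    - (x * - x)  ≈⟨ -‿cong (-‿distribʳ-* x x) ⟨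
    - - (x * x)  ≈⟨ -‿involutive (x * x) ⟩
    x * x        ∎
    where
    0≤-x : 0# ≤ - x
    0≤-x = begin
      0#      ≤⟨ x≤y⇒0≤y-x x≤0 ⟩
      0# - x  ≈⟨ +-identityˡ (- x) ⟩
      - x     ∎

  0≤1 : 0# ≤ 1#
  0≤1 = begin
    0#       ≤⟨ 0≤x*x 1# ⟩
    1# * 1#  ≈⟨ *-identityˡ 1# ⟩
    1#       ∎

  -- Here `y` equals `x * (y * y)`, a nonnegative element times a square, so no case split on the
  -- sign of `y` arises.
  inverse-nonNeg : ∀ {x y} → 0# ≤ x → x * y ≈ 1# → 0# ≤ y
  inverse-nonNeg {x} {y} 0≤x xy≈1 = begin
    0#           ≤⟨ *-nonNeg 0≤x (0≤x*x y) ⟩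
    x * (y * y)  ≈⟨ *-assoc x y y ⟨
    x * y * y    ≈⟨ *-congʳ xy≈1 ⟩
    1# * y       ≈⟨ *-identityˡ y ⟩
    y            ∎

  -- Raising `y` to `x` only increases the sum, and then the weights add up to `1#`.
  convex-≤ : ∀ {α x y} → α ≤ 1# → y ≤ x → α * x + (1# - α) * y ≤ x
  convex-≤ {α} {x} {y} α≤1 y≤x = begin
    α * x + (1# - α) * y  ≤⟨ +-monoʳ-≤ (α * x) (*-monoʳ-≤-nonNeg (1# - α) (x≤y⇒0≤y-x α≤1) y≤x) ⟩
    α * x + (1# - α) * x  ≈⟨ distribʳ x α (1# - α) ⟨
    (α + (1# - α)) * x    ≈⟨ *-congʳ (x+[y-x]≈y α 1#) ⟩
    1# * x                ≈⟨ *-identityˡ x ⟩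
    x                     ∎

  sum-nonNeg : ∀ {n} (v : Vector Carrier n) → (∀ e → 0# ≤ v e) → 0# ≤ sum v
  sum-nonNeg {zero}  v 0≤v = ≤-refl
  sum-nonNeg {suc n} v 0≤v =
    ≤-trans (0≤v zero) (x≤x+y (sum-nonNeg (tail v) (λ e → 0≤v (suc e))))

module MinMaxProperties {c ℓ₁ ℓ₂} (𝔽 : OrderedField c ℓ₁ ℓ₂) where

  open OrderedField 𝔽 hiding (zero)
  open OrderedFieldProperties 𝔽
  open MinMax 𝔽
  open Extrema totalOrder using (min≤⊤; ⊥≤max; v≤min⁺; min≤v⁺)
  open ≤-Reasoning poset

  F-nonNeg : ∀ {n} (X : Subset n) (cost : Vector Carrier n) →
             (∀ e → 0# ≤ cost e) → 0# ≤ F X cost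
  F-nonNeg X cost 0≤cost =
    sum-nonNeg _ (λ e → if-nonNeg (does (e ∈? X)) (0≤cost e))
    where
    if-nonNeg : ∀ (b : Bool) {x} → 0# ≤ x → 0# ≤ (if b then x else 0#)
    if-nonNeg true  0≤x = 0≤x
    if-nonNeg false _   = ≤-refl

  -- The head of `v` is the starting value of both folds and so lies between the two results.
  minimum≤maximum : ∀ {k} (v : Vector Carrier (suc k)) → minimum v ≤ maximum v
  minimum≤maximum v = ≤-trans (min≤⊤ _ (toList (tail v))) (⊥≤max _ (toList (tail v)))

  minimum-nonNeg : ∀ {k} (v : Vector Carrier (suc k)) →
                   (∀ j → 0# ≤ v j) → 0# ≤ minimum v
  minimum-nonNeg v 0≤v = v≤min⁺ (0≤v zero) (tabulate⁺ (λ j → 0≤v (suc j)))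

  module _ {p q} {P : Problem p q} (I : Instance P) where

    open Problem P
    open Instance I

    minCost-nonNeg : ∀ X → 0# ≤ minCost X
    minCost-nonNeg X =
      minimum-nonNeg _ (λ j → F-nonNeg X (scenario j) (nonNeg j))

    minCost≤maxCost : ∀ X → minCost X ≤ maxCost X
    minCost≤maxCost X = minimum≤maximum (λ j → F X (scenario j))

    optimum≤maxCost : ∀ {X} → Φ X → optimum ≤ maxCost X
    -- `inj₂` picks the list rather than the default value: `X` survives the filter, so its own cost
    -- is the witness.
    optimum≤maxCost {X} X∈Φ = min≤v⁺ _ _ (inj₂ (lose
      (∈-map⁺ maxCost (∈-filter⁺ (feasible? index) (∈-allSubsets X) X∈Φ))
      ≤-refl))

    α*maxCost≤OWA : ∀ {α} → α ≤ 1# → ∀ X → α * maxCost X ≤ OWA α X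
    α*maxCost≤OWA α≤1 X =
      x≤x+y (*-nonNeg (x≤y⇒0≤y-x α≤1) (minCost-nonNeg X))

    OWA≤maxCost : ∀ {α} → α ≤ 1# → ∀ X → OWA α X ≤ maxCost X
    OWA≤maxCost α≤1 X = convex-≤ α≤1 (minCost≤maxCost X)

    -- Each alternative makes one factor of the summand `(1# - α) * minCost X` zero.
    OWA≈α*maxCost : ∀ {α} X → α ≈ 1# ⊎ minCost X ≈ 0# →
                    OWA α X ≈ α * maxCost X
    OWA≈α*maxCost {α} X cond = begin-equality
      α * maxCost X + (1# - α) * minCost X  ≈⟨ +-congˡ (vanishes cond) ⟩
      α * maxCost X + 0#                    ≈⟨ +-identityʳ _ ⟩
      α * maxCost X                         ∎
      where
      vanishes : α ≈ 1# ⊎ minCost X ≈ 0# → (1# - α) * minCost X ≈ 0#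
      vanishes (inj₁ α≈1) = begin-equality
        (1# - α) * minCost X   ≈⟨ *-congʳ (+-congˡ (-‿cong α≈1)) ⟩
        (1# - 1#) * minCost X  ≈⟨ *-congʳ (-‿inverseʳ 1#) ⟩
        0# * minCost X         ≈⟨ zeroˡ _ ⟩
        0#                     ∎
      vanishes (inj₂ m≈0) = begin-equality
        (1# - α) * minCost X   ≈⟨ *-congˡ m≈0 ⟩
        (1# - α) * 0#          ≈⟨ zeroʳ _ ⟩
        0#                     ∎

    output-maxCost≤ : ∀ {γ} → 0# ≤ γ → (A : ApproximationAlgorithm P γ) →
      ∀ {X} → Φ X →
      maxCost (ApproximationAlgorithm.output A I) ≤ γ * maxCost X
    output-maxCost≤ {γ} 0≤γ A X∈Φ = ≤-trans
      (ApproximationAlgorithm.ratio A I)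
      (*-monoʳ-≤-nonNeg γ 0≤γ (optimum≤maxCost X∈Φ))

theorem8 : ∀ {c ℓ₁ ℓ₂ p q} (𝔽 : OrderedField c ℓ₁ ℓ₂) (P : Problem p q) →
  let open OrderedField 𝔽
      open MinMax 𝔽
  in
  (γ : Carrier) → 1# < γ →
  (A : ApproximationAlgorithm P γ) (I : Instance P) →
  let open Instance I
      X̂ = ApproximationAlgorithm.output A I
  in
  (α : Carrier) (0<α : 0# < α) → α ≤ 1# →
  (X : Solution) → Φ X →
  (α ≈ 1# ⊎ minCost X̂ ≈ 0# → OWA α X̂ ≤ γ * OWA α X) ×
  (α < 1# → OWA α X̂ ≤ γ / α ⟨ 0<α ⟩ * OWA α X)
theorem8 𝔽 P γ 1<γ A I α 0<α α≤1 X X∈Φ = exact , scaled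
  where
  open OrderedField 𝔽
  open OrderedFieldProperties 𝔽
  open MinMax 𝔽
  open MinMaxProperties 𝔽
  open Instance I
  open ≤-Reasoning poset

  X̂ : Solution
  X̂ = ApproximationAlgorithm.output A I

  0≤γ : 0# ≤ γ
  0≤γ = ≤-trans 0≤1 (proj₁ 1<γ)

  maxCost-X̂≤ : maxCost X̂ ≤ γ * maxCost X
  maxCost-X̂≤ = output-maxCost≤ I 0≤γ A X∈Φ

  exact : α ≈ 1# ⊎ minCost X̂ ≈ 0# → OWA α X̂ ≤ γ * OWA α X
  exact cond = begin
    OWA α X̂              ≈⟨ OWA≈α*maxCost I X̂ cond ⟩
    α * maxCost X̂        ≤⟨ *-monoʳ-≤-nonNeg α (proj₁ 0<α) maxCost-X̂≤ ⟩
    α * (γ * maxCost X)  ≈⟨ *-assoc α γ _ ⟨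
    -- Moving `α` next to `maxCost X` forms the term that `OWA α X` dominates.
    α * γ * maxCost X    ≈⟨ *-congʳ (*-comm α γ) ⟩
    γ * α * maxCost X    ≈⟨ *-assoc γ α _ ⟩
    γ * (α * maxCost X)  ≤⟨ *-monoʳ-≤-nonNeg γ 0≤γ (α*maxCost≤OWA I α≤1 X) ⟩
    γ * OWA α X          ∎

  -- The same inverse that `γ / α ⟨ 0<α ⟩` unfolds to, so `γ * α⁻¹` matches the goal by definition.
  α⁻¹ : Carrier
  α⁻¹ = proj₁ (inverse α (proj₂ 0<α))

  α*α⁻¹≈1 : α * α⁻¹ ≈ 1#
  α*α⁻¹≈1 = proj₂ (inverse α (proj₂ 0<α))

  scaled : α < 1# → OWA α X̂ ≤ γ / α ⟨ 0<α ⟩ * OWA α X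
  scaled _ = begin
    OWA α X̂                      ≤⟨ OWA≤maxCost I α≤1 X̂ ⟩
    maxCost X̂                    ≤⟨ maxCost-X̂≤ ⟩
    γ * maxCost X                ≈⟨ *-congʳ (*-identityʳ γ) ⟨
    -- `1#` is expanded to `α⁻¹ * α`: the factor `α` is spent on comparing `α * maxCost X` with
    -- `OWA α X`, and `α⁻¹` remains in the ratio.
    γ * 1# * maxCost X           ≈⟨ *-congʳ (*-congˡ (trans (*-comm α⁻¹ α) α*α⁻¹≈1)) ⟨
    γ * (α⁻¹ * α) * maxCost X    ≈⟨ *-congʳ (*-assoc γ α⁻¹ α) ⟨
    γ * α⁻¹ * α * maxCost X      ≈⟨ *-assoc (γ * α⁻¹) α _ ⟩
    γ * α⁻¹ * (α * maxCost X)    ≤⟨ *-monoʳ-≤-nonNeg (γ * α⁻¹) 0≤γ*α⁻¹ (α*maxCost≤OWA I α≤1 X) ⟩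
    γ * α⁻¹ * OWA α X            ∎
    where
    0≤γ*α⁻¹ : 0# ≤ γ * α⁻¹
    0≤γ*α⁻¹ = *-nonNeg 0≤γ (inverse-nonNeg (proj₁ 0<α) α*α⁻¹≈1)
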